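{- For any positive integers $n$ and $k$, if $n < k^2+2k+3$, then $\varGamma(n;k)=\emptyset$.
   Context: All graphs are simple, finite and undirected. The circumference $c(G)$ of a graph $G$ is the number of vertices in a longest cycle of $G$. A graph is Hamiltonian if it contains a cycle through all of its vertices. For positive integers $n$ and $k$ with $n \ge k$, $\varGamma(n;k)$ denotes the set of all graphs $G$ of order $n$ such that $c(G)=n-k$ and every induced subgraph of $G$ with $n-k$ vertices is Hamiltonian. -}

module Defs where

open import Data.Nat using (ℕ; suc; _≤_; _∸_)
open import Data.Bool using (Bool; true; false)
open import Data.Fin using (Fin; zero; suc; inject₁; fromℕ)
open import Data.Product using (Σ; ∃; _×_)
open import Relation.Binary.PropositionalEquality using (_≡_)
open import Relation.Nullary using (¬_)
open import Function.Definitions using (Injective)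

record Graph (n : ℕ) : Set where
  field
    adj   : Fin n → Fin n → Bool
    sym   : ∀ u v → adj u v ≡ adj v u
    irrefl : ∀ v → adj v v ≡ false
open Graph public

Adj : ∀ {n} → Graph n → Fin n → Fin n → Set
Adj G u v = adj G u v ≡ true

record CycleOfLength {n : ℕ} (G : Graph n) (len : ℕ) : Set where
  field
    m       : ℕ
    len≡    : len ≡ suc m
    atLeast3 : 3 ≤ suc m
    vert    : Fin (suc m) → Fin n
    inj     : Injective _≡_ _≡_ vert
    step    : ∀ (i : Fin m) → Adj G (vert (inject₁ i)) (vert (suc i))
    close   : Adj G (vert (fromℕ m)) (vert zero)

Circumference : ∀ {n} → Graph n → ℕ → Set
Circumference G ℓ = CycleOfLength G ℓ × (∀ ℓ' → CycleOfLength G ℓ' → ℓ' ≤ ℓ)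

Hamiltonian : ∀ {n} → Graph n → Set
Hamiltonian {n} G = CycleOfLength G n

-- Induced subgraph on the image of an injective map f : Fin m → Fin n
-- (vertex subsets of size m correspond to such embeddings up to relabelling).
induced : ∀ {n m} → (G : Graph n) → (f : Fin m → Fin n) → Graph m
induced G f = record
  { adj = λ i j → adj G (f i) (f j)
  ; sym = λ i j → sym G (f i) (f j)
  ; irrefl = λ i → irrefl G (f i)
  }

InΓ : (n k : ℕ) → Graph n → Set
InΓ n k G =
  Circumference G (n ∸ k) ×
  (∀ (f : Fin (n ∸ k) → Fin n) → Injective _≡_ _≡_ f → Hamiltonian (induced G f))

{-# OPTIONS --safe #-}
module Submission where

-- Put m = n - k. Every k-set R of vertices is missed by a longest cycle, which runs through all m
-- other vertices.
--  * Each vertex has degree at least k + 2: otherwise delete all but one of its neighbours.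
--  * There is an induced path q₀ … q_(k-1): an induced path is prolonged at q₀ by the successor of
--    q₀ on a cycle missing the remaining path vertices.
--  * Take R to be this path, let c be the cycle missing it, and let S_i be the set of positions on
--    c of neighbours of q_i. Since c is longest, positions in S_i and S_l are, if different, at
--    distance at least |i - l| + 2. Hence S₀ and the sets S_i - (i + 1) modulo m, 0 ≤ i < k, are
--    pairwise disjoint, so m ≥ |S₀| + |S₀| + |S₁| + … + |S_(k-1)|. As q_i has at most two
--    neighbours on the path, and the ends at most one, the right-hand side is at least k² + k + 3.

open import Defs
open import Data.Nat using (ℕ; _≤_; _<_; _+_; _*_)
open import Relation.Nullary using (¬_)
open import Data.Bool using (true)
open import Data.Bool.Properties using () renaming (_≟_ to _≟ᵇ_)
open import Data.Empty using (⊥; ⊥-elim)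
open import Data.Fin using (Fin; zero; suc; toℕ; fromℕ<; inject≤; inject₁; fromℕ)
open import Data.Fin.Properties
  using (injective⇒≤; toℕ-injective; toℕ<n; toℕ-fromℕ<; toℕ-fromℕ; toℕ-inject₁; inject≤-injective)
  renaming (_≟_ to _≟ᶠ_)
open import Data.List
  using (List; []; _∷_; _++_; length; lookup; filter;
        take; map; applyUpTo; upTo; allFin)
open import Data.List.Properties
  using (length-++; length-applyUpTo; length-map; length-take;
        length-tabulate; length-upTo)
open import Data.List.Membership.DecPropositional using () renaming (_∈?_ to mem?)
open import Data.List.Membership.Propositional using (_∈_; _∉_)
open import Data.List.Membership.Propositional.Properties
  using (∈-lookup; ∈-allFin; ∈-filter⁺; ∈-filter⁻; ∈-++⁺ˡ; ∈-++⁺ʳ; ∈-++⁻;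
         ∈-applyUpTo⁺; ∈-applyUpTo⁻; ∈-map⁺; ∈-upTo⁺)
open import Data.List.Relation.Binary.Subset.Propositional using (_⊆_)
open import Data.List.Relation.Unary.All as All using ()
open import Data.List.Relation.Unary.All.Properties using (¬Any⇒All¬)
open import Data.List.Relation.Unary.AllPairs using ([]; _∷_)
open import Data.List.Relation.Unary.Any using (here; there; index)
open import Data.List.Relation.Unary.Any.Properties using (lookup-index)
open import Data.List.Relation.Unary.Unique.Propositional using (Unique)
open import Data.List.Relation.Unary.Unique.Propositional.Properties
  using (++⁺; applyUpTo⁺₁; allFin⁺; filter⁺; upTo⁺; take⁺)
open import Data.Nat using (zero; suc; pred; z≤n; s≤s; _≤?_; NonZero)
open import Data.Nat.DivMod
open import Data.Nat.Divisibility using (divides; ∣m+n∣m⇒∣n; ∣⇒≤)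
open import Data.Nat.Properties
open import Data.Nat.Tactic.RingSolver using (solve-∀)
open import Data.Product using (∃-syntax; _×_; _,_; proj₁; proj₂)
open import Data.Sum using (_⊎_; inj₁; inj₂)
open import Function using (_∘_)
open import Function.Definitions using (Injective)
open import Relation.Binary.Definitions using (tri<; tri≈; tri>)
open import Relation.Binary.PropositionalEquality
  using (_≡_; _≢_; refl; trans; cong; cong₂; subst; subst₂; module ≡-Reasoning)
  renaming (sym to ≡-sym)
open import Relation.Nullary using (Dec; yes; no; ¬?; contradiction)

private
  variable
    A : Set
    n : ℕ

-- Counting with duplicate-free lists of vertices.

lookup-injective : {xs : List A} → Unique xs → Injective _≡_ _≡_ (lookup xs)
lookup-injective (_ ∷ _)  {zero}  {zero}  _  = refl
lookup-injective (x≢ ∷ _) {zero}  {suc j} eq = ⊥-elim (All.lookup x≢ (∈-lookup j) eq)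
lookup-injective (x≢ ∷ _) {suc i} {zero}  eq = ⊥-elim (All.lookup x≢ (∈-lookup i) (≡-sym eq))
lookup-injective (_ ∷ u)  {suc i} {suc j} eq = cong suc (lookup-injective u eq)

-- Sending each position of `xs` to a position of the same element in `ys` is injective. Every
-- cardinality comparison below goes through this pigeonhole principle.
unique-⊆⇒length≤ : {xs ys : List A} → Unique xs → xs ⊆ ys → length xs ≤ length ys
unique-⊆⇒length≤ {xs = xs} {ys} u sub = injective⇒≤ {f = f} λ {i} {j} eq →
  lookup-injective u (trans (lookup-index (sub (∈-lookup i)))
    (trans (cong (lookup ys) eq) (≡-sym (lookup-index (sub (∈-lookup j))))))
  where
  f : Fin (length xs) → Fin (length ys)
  f i = index (sub (∈-lookup i))

_∈ᶠ?_ : (v : Fin n) (xs : List (Fin n)) → Dec (v ∈ xs)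
_∈ᶠ?_ = mem? _≟ᶠ_

complement : List (Fin n) → List (Fin n)
complement xs = filter (λ v → ¬? (v ∈ᶠ? xs)) (allFin _)

∈-complement⁺ : {xs : List (Fin n)} {v : Fin n} → v ∉ xs → v ∈ complement xs
∈-complement⁺ {xs = xs} = ∈-filter⁺ (λ v → ¬? (v ∈ᶠ? xs)) (∈-allFin _)

∈-complement⁻ : {xs : List (Fin n)} {v : Fin n} → v ∈ complement xs → v ∉ xs
∈-complement⁻ {xs = xs} = proj₂ ∘ ∈-filter⁻ (λ v → ¬? (v ∈ᶠ? xs)) {xs = allFin _}

complement-unique : (xs : List (Fin n)) → Unique (complement xs)
complement-unique xs = filter⁺ (λ v → ¬? (v ∈ᶠ? xs)) (allFin⁺ _)

length-allFin : ∀ n → length (allFin n) ≡ n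
length-allFin n = length-tabulate {n = n} (λ i → i)

n≤length+complement : (xs : List (Fin n)) → n ≤ length xs + length (complement xs)
n≤length+complement {n} xs = subst₂ _≤_ (length-allFin n) (length-++ xs)
  (unique-⊆⇒length≤ (allFin⁺ n) sub)
  where
  sub : allFin n ⊆ xs ++ complement xs
  sub {v} _ with v ∈ᶠ? xs
  ... | yes v∈ = ∈-++⁺ˡ v∈
  ... | no  v∉ = ∈-++⁺ʳ xs (∈-complement⁺ v∉)

take-++-⊇ : (xs ys : List A) {k : ℕ} → length xs ≤ k → xs ⊆ take k (xs ++ ys)
take-++-⊇ (x ∷ xs) ys (s≤s _)  (here eq)  = here eq
take-++-⊇ (x ∷ xs) ys (s≤s le) (there v∈) = there (take-++-⊇ xs ys le v∈)

take-⊆ : (k : ℕ) (xs : List A) → take k xs ⊆ xs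
take-⊆ (suc k) (x ∷ xs) (here eq)  = here eq
take-⊆ (suc k) (x ∷ xs) (there v∈) = there (take-⊆ k xs v∈)

-- Pad `xs` with vertices outside `v ∷ xs` and cut after `k` entries; as `k < n`, there are enough
-- of them. This turns a small set to be deleted into one of exactly `k` vertices, while `v`
-- survives.
extend-avoiding : {k : ℕ} (v : Fin n) (xs : List (Fin n)) → Unique xs → v ∉ xs →
  length xs ≤ k → k < n → ∃[ R ] (Unique R × length R ≡ k × xs ⊆ R × v ∉ R)
extend-avoiding {n} {k} v xs u v∉ le k<n =
  take k all , take⁺ k all-unique , len , take-++-⊇ xs rest le , v∉R ∘ take-⊆ k all
  where
  rest = complement (v ∷ xs)
  all  = xs ++ rest
  all-unique : Unique all
  all-unique = ++⁺ u (complement-unique (v ∷ xs)) λ (a , b) → ∈-complement⁻ {xs = v ∷ xs} b (there a)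
  k≤ : k ≤ length all
  k≤ = subst (k ≤_) (≡-sym (length-++ xs))
    (≤-pred (≤-trans k<n (n≤length+complement (v ∷ xs))))
  len : length (take k all) ≡ k
  len = trans (length-take k all) (m≤n⇒m⊓n≡m k≤)
  v∉R : v ∉ all
  v∉R v∈ with ∈-++⁻ xs v∈
  ... | inj₁ a = v∉ a
  ... | inj₂ b = ∈-complement⁻ {xs = v ∷ xs} b (here refl)

-- Remainders modulo the length of a cycle.

m%o≢[m+n]%o : ∀ m {n o} .{{_ : NonZero n}} .{{_ : NonZero o}} → n < o → m % o ≢ (m + n) % o
m%o≢[m+n]%o m {n} {o} n<o eq = <⇒≱ n<o (∣⇒≤ (∣m+n∣m⇒∣n (divides ((m + n) / o) same) (divides (m / o) refl)))
  where
  same : m / o * o + n ≡ (m + n) / o * o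
  same = +-cancelˡ-≡ (m % o) _ _ (begin
    m % o + (m / o * o + n)          ≡⟨ +-assoc (m % o) _ n ⟨
    m % o + m / o * o + n            ≡⟨ cong (_+ n) (m≡m%n+[m/n]*n m o) ⟨
    m + n                            ≡⟨ m≡m%n+[m/n]*n (m + n) o ⟩
    (m + n) % o + (m + n) / o * o    ≡⟨ cong (_+ (m + n) / o * o) eq ⟨
    m % o + (m + n) / o * o          ∎)
    where open ≡-Reasoning

-- The two cases are the two kinds of edges in `CycleOfLength`: an inner `step`, or the `close` edge
-- that wraps around.
suc-%-suc : ∀ t m →
  (suc t % suc m ≡ suc (t % suc m) × t % suc m < m) ⊎ (suc t % suc m ≡ 0 × t % suc m ≡ m)
suc-%-suc t m with m≤n⇒m<n∨m≡n (≤-pred (m%n<n t (suc m)))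
    | trans (cong (λ x → suc x % suc m) (m≡m%n+[m/n]*n t (suc m)))
            ([m+kn]%n≡m%n (suc (t % suc m)) (t / suc m) (suc m))
... | inj₁ r<m | step = inj₁ (trans step (m<n⇒m%n≡m (s≤s r<m)) , r<m)
... | inj₂ r≡m | step =
  inj₂ (trans step (trans (cong (λ x → suc x % suc m) r≡m) (n%n≡0 (suc m))) , r≡m)

-- Splicing sequences.

prepend : A → (ℕ → A) → ℕ → A
prepend x f zero    = x
prepend x f (suc i) = f i

glue : ℕ → (ℕ → A) → (ℕ → A) → ℕ → A
glue zero    f g t       = g t
glue (suc ℓ) f g zero    = f zero
glue (suc ℓ) f g (suc t) = glue ℓ (f ∘ suc) g t

glue-< : (ℓ : ℕ) (f g : ℕ → A) {t : ℕ} → t < ℓ → glue ℓ f g t ≡ f t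
glue-< (suc ℓ) f g {zero}  _         = refl
glue-< (suc ℓ) f g {suc t} (s≤s t<ℓ) = glue-< ℓ (f ∘ suc) g t<ℓ

glue-+ : (ℓ : ℕ) (f g : ℕ → A) (u : ℕ) → glue ℓ f g (ℓ + u) ≡ g u
glue-+ zero    f g u = refl
glue-+ (suc ℓ) f g u = glue-+ ℓ (f ∘ suc) g u

<-or-+ : ∀ ℓ t → t < ℓ ⊎ ∃[ u ] t ≡ ℓ + u
<-or-+ ℓ t with <-≤-connex t ℓ
... | inj₁ t<ℓ = inj₁ t<ℓ
... | inj₂ ℓ≤t with m≤n⇒∃[o]m+o≡n ℓ≤t
...   | u , eq = inj₂ (u , ≡-sym eq)

-- Cycles as periodic walks, and the joining of two paths into a cycle.

-- A cycle of length m is encoded as an m-periodic walk on ℕ.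
record CycleAvoiding (G : Graph n) (R : List (Fin n)) (m : ℕ) : Set where
  field
    c        : ℕ → Fin n
    adjacent : ∀ t → Adj G (c t) (c (suc t))
    periodic : ∀ t → c (t + m) ≡ c t
    distinct : ∀ s {d e} → d < e → e < m → c (s + d) ≢ c (s + e)
    avoids   : ∀ t → c t ∉ R

module _ (G : Graph n) where

  private
    _~_ : Fin n → Fin n → Set
    u ~ v = Adj G u v

  ~-sym : ∀ {u v} → u ~ v → v ~ u
  ~-sym {u} {v} a = trans (Graph.sym G v u) a

  ~-irrefl : ∀ {v} → ¬ (v ~ v)
  ~-irrefl {v} a with trans (≡-sym a) (irrefl G v)
  ... | ()

  cycle⇒cycleAvoiding : ∀ {m R} (f : Fin m → Fin n) → Injective _≡_ _≡_ f → (∀ i → f i ∉ R) →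
    Hamiltonian (induced G f) → CycleAvoiding G R m
  cycle⇒cycleAvoiding {R = R} f f-inj f∉
    record { m = m ; len≡ = refl ; vert = vert ; inj = inj ; step = step ; close = close } = record
    { c = c ; adjacent = adjacent ; periodic = periodic ; distinct = distinct ; avoids = λ t → f∉ _ }
    where
    pos : ℕ → Fin (suc m)
    pos t = t mod suc m
    toℕ-pos : ∀ t → toℕ (pos t) ≡ t % suc m
    toℕ-pos t = toℕ-fromℕ< (m%n<n t (suc m))
    c : ℕ → Fin n
    c t = f (vert (pos t))
    c-cong : ∀ {i j} → i ≡ j → f (vert i) ≡ f (vert j)
    c-cong = cong (f ∘ vert)
    adjacent : ∀ t → c t ~ c (suc t)
    adjacent t with suc-%-suc t m
    ... | inj₁ (eq , r<m) = subst₂ _~_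
      (c-cong (toℕ-injective (trans (toℕ-inject₁ (fromℕ< r<m)) (trans (toℕ-fromℕ< r<m) (≡-sym (toℕ-pos t))))))
      (c-cong (toℕ-injective (trans (cong suc (toℕ-fromℕ< r<m)) (trans (≡-sym eq) (≡-sym (toℕ-pos (suc t)))))))
      (step (fromℕ< r<m))
    ... | inj₂ (eq , r≡m) = subst₂ _~_
      (c-cong (toℕ-injective (trans (toℕ-fromℕ m) (trans (≡-sym r≡m) (≡-sym (toℕ-pos t))))))
      (c-cong (toℕ-injective (trans (≡-sym eq) (≡-sym (toℕ-pos (suc t))))))
      close
    periodic : ∀ t → c (t + suc m) ≡ c t
    periodic t = c-cong (toℕ-injective (trans (toℕ-pos (t + suc m)) (trans ([m+n]%n≡m%n t (suc m)) (≡-sym (toℕ-pos t)))))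
    distinct : ∀ s {d e} → d < e → e < suc m → c (s + d) ≢ c (s + e)
    -- The two positions differ by `suc o = e - d`, which lies strictly between 0 and the cycle
    -- length, so their residues differ.
    distinct s {d} {e} d<e e<m eq with m≤n⇒∃[o]m+o≡n d<e
    ... | o , refl = m%o≢[m+n]%o (s + d) {suc o} {suc m} (≤-<-trans (s≤s (m≤n+m o d)) e<m)
      (trans (≡-sym (toℕ-pos (s + d))) (trans (cong toℕ (inj (f-inj eq))) (trans (toℕ-pos (s + suc (d + o)))
        (cong (_% suc m) (trans (cong (s +_) (≡-sym (+-suc d o))) (≡-sym (+-assoc s d (suc o))))))))

  walk⇒cycle : (g : ℕ → Fin n) (m : ℕ) → 3 ≤ suc m → (∀ {i j} → i < j → j ≤ m → g i ≢ g j) →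
    (∀ {i} → i < m → g i ~ g (suc i)) → g m ~ g 0 → CycleOfLength G (suc m)
  walk⇒cycle g m m≥3 g-inj g-adj g-close = record
    { m = m ; len≡ = refl ; atLeast3 = m≥3 ; vert = g ∘ toℕ ; inj = inj
    ; step = λ i → subst (λ x → g x ~ g (suc (toℕ i))) (≡-sym (toℕ-inject₁ i)) (g-adj (toℕ<n i))
    ; close = subst (λ x → g x ~ g 0) (≡-sym (toℕ-fromℕ m)) g-close }
    where
    inj : Injective _≡_ _≡_ (g ∘ toℕ)
    inj {i} {j} eq with toℕ i ≟ toℕ j
    ... | yes e = toℕ-injective e
    ... | no ¬e with ≤-total (toℕ i) (toℕ j)
    ...   | inj₁ le = ⊥-elim (g-inj (≤∧≢⇒< le ¬e) (≤-pred (toℕ<n j)) eq)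
    ...   | inj₂ le = ⊥-elim (g-inj (≤∧≢⇒< le (¬e ∘ ≡-sym)) (≤-pred (toℕ<n i)) (≡-sym eq))

  -- Run along `f` up to `f e`, cross to `g 0`, run along `g` up to `g r`, and return to `f 0`.
  -- Every cycle that is played off against the circumference is built this way.
  join-paths : (f g : ℕ → Fin n) (e r : ℕ) → 3 ≤ suc e + suc r →
    (∀ {i j} → i < j → j ≤ e → f i ≢ f j) → (∀ {i} → i < e → f i ~ f (suc i)) →
    (∀ {i j} → i < j → j ≤ r → g i ≢ g j) → (∀ {i} → i < r → g i ~ g (suc i)) →
    (∀ {i j} → j ≤ r → f i ≢ g j) →
    f e ~ g 0 → g r ~ f 0 → CycleOfLength G (suc e + suc r)
  join-paths f g e r ≥3 f-inj f-adj g-inj g-adj f≢g fg gf =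
    walk⇒cycle h (e + suc r) ≥3 h-inj h-adj
      (subst (_~ f 0) (≡-sym (trans (cong h (+-suc e r)) (h-+ r))) gf)
    where
    ℓ = suc e
    h = glue ℓ f g
    h-< : ∀ {t} → t < ℓ → h t ≡ f t
    h-< = glue-< ℓ f g
    h-+ : ∀ u → h (ℓ + u) ≡ g u
    h-+ = glue-+ ℓ f g
    u≤r : ∀ {u} → ℓ + u ≤ e + suc r → u ≤ r
    u≤r {u} le = +-cancelˡ-≤ ℓ u r (≤-trans le (≤-reflexive (+-suc e r)))
    h-inj : ∀ {i j} → i < j → j ≤ e + suc r → h i ≢ h j
    h-inj {i} {j} i<j j≤ eq with <-or-+ ℓ i | <-or-+ ℓ j
    ... | inj₁ i<ℓ | inj₁ j<ℓ = f-inj i<j (≤-pred j<ℓ) (subst₂ _≡_ (h-< i<ℓ) (h-< j<ℓ) eq)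
    ... | inj₁ i<ℓ | inj₂ (u , refl) = f≢g (u≤r j≤) (subst₂ _≡_ (h-< i<ℓ) (h-+ u) eq)
    ... | inj₂ (u , refl) | inj₁ j<ℓ = <⇒≱ (<-trans i<j j<ℓ) (m≤m+n ℓ u)
    ... | inj₂ (u , refl) | inj₂ (w , refl) =
      g-inj (+-cancelˡ-< ℓ u w i<j) (u≤r j≤) (subst₂ _≡_ (h-+ u) (h-+ w) eq)
    h-adj : ∀ {i} → i < e + suc r → h i ~ h (suc i)
    h-adj {i} i< with <-or-+ ℓ i
    ... | inj₂ (u , refl) = subst₂ _~_ (≡-sym (h-+ u)) (≡-sym (trans (cong h (≡-sym (+-suc ℓ u))) (h-+ (suc u))))
      (g-adj (u≤r (≤-trans (≤-reflexive (+-suc ℓ u)) i<)))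
    ... | inj₁ i<ℓ with m≤n⇒m<n∨m≡n (≤-pred i<ℓ)
    ...   | inj₁ i<e = subst₂ _~_ (≡-sym (h-< i<ℓ)) (≡-sym (h-< (s≤s i<e))) (f-adj i<e)
    ...   | inj₂ refl = subst₂ _~_ (≡-sym (h-< i<ℓ))
      (≡-sym (trans (cong (h ∘ suc) (≡-sym (+-identityʳ e))) (h-+ 0))) fg

  -- Induced paths and neighbour lists.

  record IsInducedPath (q : ℕ → Fin n) (t : ℕ) : Set where
    field
      -- Here `t` counts vertices, not edges; the values of `q` from `t` on are arbitrary.
      distinct : ∀ {i j} → i < j → j < t → q i ≢ q j
      adjacent : ∀ {i} → suc i < t → q i ~ q (suc i)
      chordless : ∀ {i j} → suc i < j → j < t → ¬ (q i ~ q j)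

    vertices-unique : Unique (applyUpTo q t)
    vertices-unique = applyUpTo⁺₁ q t distinct

  neighbours : Fin n → List (Fin n)
  neighbours v = filter (λ u → adj G v u ≟ᵇ true) (allFin n)

  ∈-neighbours⁺ : ∀ {v u} → v ~ u → u ∈ neighbours v
  ∈-neighbours⁺ {v} {u} = ∈-filter⁺ (λ u → adj G v u ≟ᵇ true) (∈-allFin u)

  ∈-neighbours⁻ : ∀ {v u} → u ∈ neighbours v → v ~ u
  ∈-neighbours⁻ {v} = proj₂ ∘ ∈-filter⁻ (λ u → adj G v u ≟ᵇ true) {xs = allFin n}

  neighbours-unique : ∀ v → Unique (neighbours v)
  neighbours-unique v = filter⁺ (λ u → adj G v u ≟ᵇ true) (allFin⁺ n)

  -- Longest cycles missing `k` prescribed vertices.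

  module _ (k o : ℕ) (m+k≡n : 3 + o + k ≡ n)
    (longest : ∀ {ℓ} → CycleOfLength G ℓ → ℓ ≤ 3 + o)
    (hamiltonian : (f : Fin (3 + o) → Fin n) → Injective _≡_ _≡_ f → Hamiltonian (induced G f)) where

    private
      m : ℕ
      -- With this form, `2 + o` is the offset `m - 1` of the vertex just before the start of a full
      -- turn.
      m = 3 + o

    -- At least `m` vertices lie outside `R`; the first `m` of them induce a Hamiltonian subgraph.
    cycle-avoiding : ∀ {R} → length R ≡ k → CycleAvoiding G R m
    cycle-avoiding {R} |R| = cycle⇒cycleAvoiding f f-inj (λ i → ∈-complement⁻ {xs = R} (∈-lookup (inject≤ i m≤)))
      (hamiltonian f f-inj)
      where
      m≤ : m ≤ length (complement R)
      m≤ = +-cancelʳ-≤ k m _ (subst₂ _≤_ (≡-sym m+k≡n)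
        (trans (cong (_+ length (complement R)) |R|) (+-comm k _)) (n≤length+complement R))
      f : Fin m → Fin n
      f i = lookup (complement R) (inject≤ i m≤)
      f-inj : Injective _≡_ _≡_ f
      f-inj eq = inject≤-injective m≤ m≤ _ _ (lookup-injective (complement-unique R) eq)

    module _ {R : List (Fin n)} (R-unique : Unique R) (|R| : length R ≡ k) (C : CycleAvoiding G R m) where
      open CycleAvoiding C

      -- The `m` cycle vertices and the `k` vertices of `R` already make up all `n` vertices, so a
      -- vertex on neither would be one too many. The start `s` is free so that positions can be
      -- counted with a shift.
      covers : ∀ s {v} → v ∉ R → ∃[ p ] (p < m × c (s + p) ≡ v)
      covers s {v} v∉ with v ∈ᶠ? applyUpTo (λ p → c (s + p)) m
      ... | yes v∈ = let p , p<m , eq = ∈-applyUpTo⁻ (λ p → c (s + p)) v∈ in p , p<m , ≡-sym eq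
      ... | no v∉W = contradiction too-long (<⇒≱ (n<1+n n))
        where
        W = applyUpTo (λ p → c (s + p)) m
        W-disjoint : ∀ {u} → ¬ (u ∈ W × u ∈ R)
        W-disjoint (u∈W , u∈R) with ∈-applyUpTo⁻ (λ p → c (s + p)) u∈W
        ... | p , _ , refl = avoids (s + p) u∈R
        v∉WR : v ∉ W ++ R
        v∉WR v∈ with ∈-++⁻ W v∈
        ... | inj₁ a = v∉W a
        ... | inj₂ b = v∉ b
        too-long : suc n ≤ n
        too-long = subst₂ _≤_
          (cong suc (trans (length-++ W) (trans (cong₂ _+_ (length-applyUpTo (λ p → c (s + p)) m) |R|) m+k≡n)))
          (length-allFin n)
          (unique-⊆⇒length≤ {xs = v ∷ W ++ R}
            (¬Any⇒All¬ _ v∉WR ∷ ++⁺ (applyUpTo⁺₁ (λ p → c (s + p)) m (distinct s)) R-unique W-disjoint)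
            (λ {u} _ → ∈-allFin u))

    module _ {R : List (Fin n)} (C : CycleAvoiding G R m) where
      open CycleAvoiding C

      -- The arc from `c s` to `c (s + e)` is closed up by a path inside `R`, which the cycle
      -- avoids. The resulting cycle is no longer than a longest one.
      detour-short : ∀ s e r (q : ℕ → Fin n) → e < m →
        (∀ {i j} → i < j → j ≤ r → q i ≢ q j) → (∀ {i} → i < r → q i ~ q (suc i)) →
        (∀ {i} → i ≤ r → q i ∈ R) → c (s + e) ~ q 0 → q r ~ c s → suc e + suc r ≤ m
      detour-short s e r q e<m q-inj q-adj q∈ cq qc with 3 ≤? suc e + suc r
      -- Fewer than three vertices form no cycle, but then the bound is clear from `m = 3 + o`.
      ... | no ≱3 = ≤-trans (<⇒≤ (≰⇒> ≱3)) (m≤m+n 3 o)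
      ... | yes ≥3 = longest (join-paths (λ t → c (s + t)) q e r ≥3
        (λ i<j j≤e → distinct s i<j (≤-<-trans j≤e e<m))
        (λ {i} _ → subst (λ x → c (s + i) ~ c x) (≡-sym (+-suc s i)) (adjacent (s + i)))
        q-inj q-adj
        (λ {i} j≤r eq → avoids (s + i) (subst (_∈ R) (≡-sym eq) (q∈ j≤r)))
        cq (subst (λ x → q r ~ c x) (≡-sym (+-identityʳ s)) qc))

    -- The minimum degree.

    k<n : k < n
    k<n = ≤-trans (s≤s (m≤n+m k (2 + o))) (≤-reflexive m+k≡n)

    -- On a cycle missing D, both cycle neighbours of v would have to be y.
    few-neighbours-absurd : ∀ v y (D : List (Fin n)) → Unique D → v ∉ D → length D ≤ k →
      (∀ {u} → v ~ u → u ∈ y ∷ D) → ⊥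
    few-neighbours-absurd v y D D-unique v∉D |D|≤k N⊆ =
      let R , R-unique , |R| , D⊆R , v∉R = extend-avoiding v D D-unique v∉D |D|≤k k<n
          C = cycle-avoiding |R|
          open CycleAvoiding C
          p , _ , cp≡v = covers R-unique |R| C 0 v∉R
          ≡y : ∀ t → v ~ c t → c t ≡ y
          ≡y t a = case-∈ (N⊆ a) (λ b → avoids t (D⊆R b))
          next : v ~ c (p + 1)
          next = subst₂ _~_ cp≡v (cong c (≡-sym (+-comm p 1))) (adjacent p)
          prev : v ~ c (p + (2 + o))
          prev = ~-sym (subst (c (p + (2 + o)) ~_)
            (trans (cong c (≡-sym (+-suc p (2 + o)))) (trans (periodic p) cp≡v)) (adjacent (p + (2 + o))))
      -- The offsets 1 and `2 + o`, those of the successor and the predecessor of `v`, differ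
      -- because `m` is at least 3, yet both positions carry `y`.
      in distinct p (s≤s (s≤s z≤n)) (n<1+n (2 + o)) (trans (≡y _ next) (≡-sym (≡y _ prev)))
      where
      case-∈ : ∀ {u} → u ∈ y ∷ D → u ∉ D → u ≡ y
      case-∈ (here eq)  _  = eq
      case-∈ (there u∈) u∉ = ⊥-elim (u∉ u∈)

    degree≥k+2 : ∀ v → 2 + k ≤ length (neighbours v)
    degree≥k+2 v = ≮⇒≥ λ d< → few (neighbours v) refl d<
      where
      few : ∀ N → neighbours v ≡ N → length N < 2 + k → ⊥
      -- Without neighbours there is no candidate for `y`; `v` itself serves as a dummy.
      few [] eq _ = few-neighbours-absurd v v [] [] (λ ()) z≤n (λ a → there (subst (_ ∈_) eq (∈-neighbours⁺ a)))
      few (y ∷ D) eq (s≤s d≤) with subst Unique eq (neighbours-unique v)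
      ... | _ ∷ D-unique = few-neighbours-absurd v y D D-unique
        (λ v∈ → ~-irrefl (∈-neighbours⁻ (subst (v ∈_) (≡-sym eq) (there v∈))))
        (≤-pred d≤) (λ a → subst (_ ∈_) eq (∈-neighbours⁺ a))

    -- Growing an induced path.

    -- An edge from the new vertex to q_j, j ≥ 1, would let the longest cycle C absorb q₁, …, q_j.
    prepend-successor : ∀ {q t R p} (P : IsInducedPath q (suc t)) (C : CycleAvoiding G R m) →
      let open CycleAvoiding C in
      (∀ {i} → i < t → q (suc i) ∈ R) → c p ≡ q 0 → IsInducedPath (prepend (c (suc p)) q) (2 + t)
    prepend-successor {q} {t} {R} {p} P C q∈R cp≡q0 =
      record { distinct = q′-distinct ; adjacent = q′-adjacent ; chordless = q′-chordless }
      where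
      open IsInducedPath P
      module C = CycleAvoiding C
      x = C.c (suc p)
      q′ = prepend x q
      x~q0 : x ~ q 0
      x~q0 = ~-sym (subst (_~ x) cp≡q0 (C.adjacent p))
      q′-distinct : ∀ {i j} → i < j → j < 2 + t → q′ i ≢ q′ j
      q′-distinct {zero} {suc zero} _ _ eq = ~-irrefl (subst (_~ q 0) eq x~q0)
      q′-distinct {zero} {suc (suc j)} _ (s≤s (s≤s j<t)) eq =
        C.avoids (suc p) (subst (_∈ R) (≡-sym eq) (q∈R j<t))
      q′-distinct {suc i} {suc j} (s≤s i<j) (s≤s j<) = distinct i<j j<
      q′-adjacent : ∀ {i} → suc i < 2 + t → q′ i ~ q′ (suc i)
      q′-adjacent {zero} _ = x~q0
      q′-adjacent {suc i} (s≤s i<) = adjacent i<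
      q′-chordless : ∀ {i j} → suc i < j → j < 2 + t → ¬ (q′ i ~ q′ j)
      q′-chordless {suc i} {suc j} (s≤s i<j) (s≤s j<) = chordless i<j j<
      q′-chordless {zero} {suc zero} (s≤s ()) _
      -- The arc is a full turn from `x` round to `q 0` and has all `m` vertices; the detour back to
      -- `x` through `q 1`, ..., `q (suc r)` adds `suc r` more.
      q′-chordless {zero} {suc (suc r)} _ (s≤s (s≤s r<t)) x~qr = m+1+n≰m m
        (detour-short C (suc p) (2 + o) r (q ∘ suc) (n<1+n (2 + o))
          (λ i<j j≤r → distinct (s≤s i<j) (s≤s (≤-<-trans j≤r r<t)))
          (λ i<r → adjacent (s≤s (≤-<-trans i<r r<t)))
          (λ i≤r → q∈R (≤-<-trans i≤r r<t))
          (subst (_~ q 1) (≡-sym (trans (cong C.c (≡-sym (+-suc p (2 + o)))) (trans (C.periodic p) cp≡q0)))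
            (adjacent (s≤s (≤-trans (s≤s z≤n) r<t))))
          (~-sym x~qr))

    -- The deleted set contains `q 1`, ..., `q t` but not `q 0`, so the cycle passes through `q 0`
    -- and its successor there can be prepended.
    prolong : ∀ {q t} → t ≤ k → IsInducedPath q (suc t) → ∃[ q′ ] IsInducedPath q′ (2 + t)
    prolong {q} {t} t≤k P =
      let R , R-unique , |R| , T⊆R , q0∉R = extend-avoiding (q 0) T T-unique q0∉T
            (≤-trans (≤-reflexive (length-applyUpTo (q ∘ suc) t)) t≤k) k<n
          C = cycle-avoiding |R|
          p , _ , cp≡q0 = covers R-unique |R| C 0 q0∉R
      in _ , prepend-successor P C (λ i<t → T⊆R (∈-applyUpTo⁺ (q ∘ suc) i<t)) cp≡q0
      where
      open IsInducedPath P
      T = applyUpTo (q ∘ suc) t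
      T-unique : Unique T
      T-unique = applyUpTo⁺₁ (q ∘ suc) t (λ i<j j<t → distinct (s≤s i<j) (s≤s j<t))
      q0∉T : q 0 ∉ T
      q0∉T q0∈ = let i , i<t , eq = ∈-applyUpTo⁻ (q ∘ suc) q0∈ in distinct (s≤s z≤n) (s≤s i<t) eq

    induced-path : ∀ t → t ≤ k → ∃[ q ] IsInducedPath q (suc t)
    induced-path zero _ = (λ _ → fromℕ< (≤-<-trans z≤n k<n)) , record
      { distinct = λ { (s≤s _) (s≤s ()) } ; adjacent = λ { (s≤s ()) } ; chordless = λ { (s≤s _) (s≤s ()) } }
    induced-path (suc t) t<k = prolong (<⇒≤ t<k) (proj₂ (induced-path t (<⇒≤ t<k)))

    -- Counting the cycle neighbours of the path vertices.

    module _ {q : ℕ → Fin n} (P : IsInducedPath q k) (C : CycleAvoiding G (applyUpTo q k) m) where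
      open IsInducedPath P

      private
        R : List (Fin n)
        R = applyUpTo q k
        |R| : length R ≡ k
        |R| = length-applyUpTo q k
        module C = CycleAvoiding C
        open C using (c)

      path-neighbour : ∀ {i l} → i < k → l < k → q i ~ q l → l ≡ suc i ⊎ i ≡ suc l
      path-neighbour {i} {l} i<k l<k a with <-cmp i l
      ... | tri≈ _ refl _ = ⊥-elim (~-irrefl a)
      ... | tri< i<l _ _ with m≤n⇒m<n∨m≡n i<l
      ...   | inj₁ lt = ⊥-elim (chordless lt l<k a)
      ...   | inj₂ eq = inj₁ (≡-sym eq)
      path-neighbour {i} {l} i<k l<k a | tri> _ _ l<i with m≤n⇒m<n∨m≡n l<i
      ...   | inj₁ lt = ⊥-elim (chordless lt i<k (~-sym a))
      ...   | inj₂ eq = inj₂ (≡-sym eq)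

      -- The cycle neighbours of q₀ are counted twice, with the shifts 0 and 1, and those of q_i
      -- (i ≥ 1) once, with the shift i + 1; hence pred.
      hits : ℕ → List ℕ
      hits j = filter (λ p → adj G (q (pred j)) (c (j + p)) ≟ᵇ true) (upTo m)

      ∈-hits⁻ : ∀ {j p} → p ∈ hits j → p ∈ upTo m × q (pred j) ~ c (j + p)
      ∈-hits⁻ {j} = ∈-filter⁻ (λ p → adj G (q (pred j)) (c (j + p)) ≟ᵇ true) {xs = upTo m}

      -- Split the neighbours of `q (pred j)`: those on the path lie in `Y`, and each of the others
      -- is on the cycle and yields a hit, its position being counted from `j`.
      hits-bound : ∀ j (Y : List (Fin n)) → (∀ {l} → l < k → q (pred j) ~ q l → q l ∈ Y) →
        2 + k ≤ length Y + length (hits j)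
      hits-bound j Y inner = begin
        2 + k                              ≤⟨ degree≥k+2 v ⟩
        length (neighbours v)              ≤⟨ unique-⊆⇒length≤ (neighbours-unique v) sub ⟩
        length (Y ++ map at (hits j))      ≡⟨ length-++ Y ⟩
        length Y + length (map at (hits j)) ≡⟨ cong (length Y +_) (length-map at (hits j)) ⟩
        length Y + length (hits j)         ∎
        where
        open ≤-Reasoning
        v = q (pred j)
        at : ℕ → Fin n
        at p = c (j + p)
        sub : neighbours v ⊆ Y ++ map at (hits j)
        sub {u} u∈ with u ∈ᶠ? R
        ... | yes u∈R = let l , l<k , eq = ∈-applyUpTo⁻ q u∈R in
          ∈-++⁺ˡ (subst (_∈ Y) (≡-sym eq) (inner l<k (subst (v ~_) eq (∈-neighbours⁻ u∈))))
        ... | no u∉R = let p , p<m , eq = covers vertices-unique |R| C j u∉R in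
          ∈-++⁺ʳ Y (subst (_∈ map at (hits j)) eq (∈-map⁺ at
            (∈-filter⁺ (λ p → adj G v (c (j + p)) ≟ᵇ true) (∈-upTo⁺ p<m)
              (subst (v ~_) (≡-sym eq) (∈-neighbours⁻ u∈)))))

      -- Serves both lists of `q 0`, those with `j` equal to 0 and 1; only `q 1` can be a path
      -- neighbour.
      hits-first : ∀ j → pred j ≡ 0 → 0 < k → 1 + k ≤ length (hits j)
      hits-first j eq 0<k = ≤-pred (hits-bound j (q 1 ∷ []) inner)
        where
        inner : ∀ {l} → l < k → q (pred j) ~ q l → q l ∈ q 1 ∷ []
        inner {l} l<k a with path-neighbour {i = 0} 0<k l<k (subst (λ i → q i ~ q l) eq a)
        ... | inj₁ refl = here refl

      hits-middle : ∀ i → suc i < k → k ≤ length (hits (2 + i))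
      hits-middle i i<k = ≤-pred (≤-pred (hits-bound (2 + i) (q i ∷ q (2 + i) ∷ []) inner))
        where
        inner : ∀ {l} → l < k → q (suc i) ~ q l → q l ∈ q i ∷ q (2 + i) ∷ []
        inner l<k a with path-neighbour i<k l<k a
        ... | inj₁ refl = there (here refl)
        ... | inj₂ refl = here refl

      hits-last : ∀ i → 2 + i ≡ k → 1 + k ≤ length (hits k)
      hits-last i refl = ≤-pred (hits-bound k (q i ∷ []) inner)
        where
        inner : ∀ {l} → l < k → q (suc i) ~ q l → q l ∈ q i ∷ []
        inner l<k a with path-neighbour ≤-refl l<k a
        ... | inj₁ refl = ⊥-elim (<-irrefl refl l<k)
        ... | inj₂ refl = here refl

      -- For `k = 1` the path is a single vertex, so all its neighbours are on the cycle.
      hits-only : 1 ≡ k → 2 + k ≤ length (hits k)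
      hits-only refl = hits-bound k [] λ { {zero} _ a → ⊥-elim (~-irrefl a) ; {suc _} (s≤s ()) }

      acc : ℕ → List ℕ
      acc zero    = hits zero
      acc (suc j) = hits (suc j) ++ acc j

      ∈-acc⁻ : ∀ {j p} → p ∈ acc j → ∃[ i ] (i ≤ j × p ∈ hits i)
      ∈-acc⁻ {zero} p∈ = 0 , z≤n , p∈
      ∈-acc⁻ {suc j} p∈ with ∈-++⁻ (hits (suc j)) p∈
      ... | inj₁ a = suc j , ≤-refl , a
      ... | inj₂ b = let i , i≤ , h = ∈-acc⁻ {j} b in i , m≤n⇒m≤1+n i≤ , h

      acc-⊆ : ∀ {j} → acc j ⊆ upTo m
      acc-⊆ {j} p∈ = let i , _ , h = ∈-acc⁻ {j} p∈ in proj₁ (∈-hits⁻ {i} h)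

      hits-unique : ∀ j → Unique (hits j)
      hits-unique j = filter⁺ (λ p → adj G (q (pred j)) (c (j + p)) ≟ᵇ true) (upTo⁺ m)

      -- Already `hits 0` has more than `k` of the `m` positions. Hence no shift up to `k` exceeds
      -- one turn of the cycle.
      k≤m : 0 < k → k ≤ m
      k≤m 0<k = ≤-trans (n≤1+n k) (≤-trans (hits-first 0 refl 0<k) (≤-trans
        (unique-⊆⇒length≤ (hits-unique 0) (proj₁ ∘ ∈-hits⁻ {0})) (≤-reflexive (length-upTo m))))

      -- For j < j′ a common hit leaves only j′ - j - 1 cycle vertices strictly between a neighbour
      -- of q_(pred j) and one of q_(pred j′), fewer than lie on the path q_(pred j) … q_(pred j′).
      hits-disjoint : ∀ {j d p} → j + suc d ≤ k → p ∈ hits j → ¬ (p ∈ hits (j + suc d))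
      hits-disjoint {j} {d} {p} j′≤k p∈ p∈′ = 1+n≰n (begin
        suc m              ≡⟨ cong suc (trans (≡-sym e-eq) (+-comm (suc d) e)) ⟩
        suc e + suc d      ≤⟨ +-monoʳ-≤ (suc e) (s≤s d≤r) ⟩
        suc e + suc r      ≤⟨ detour-short C (j + suc d + p) e r (λ u → q (pred j + u)) e<m
                                (λ a<b b≤r → distinct (+-monoʳ-< (pred j) a<b) (inside b≤r))
                                (λ {a} a<r → subst (λ y → q (pred j + a) ~ q y) (≡-sym (+-suc (pred j) a))
                                  (adjacent (subst (_< k) (+-suc (pred j) a) (inside a<r))))
                                (λ a≤r → ∈-applyUpTo⁺ q (inside a≤r)) exit entry ⟩
        m                  ∎)
        where
        open ≤-Reasoning
        0<k : 0 < k
        0<k = ≤-trans (m≤n⇒m≤o+n j (s≤s z≤n)) j′≤k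
        -- The detour keeps the long way round: from the neighbour of the later path vertex,
        -- `e = m - suc d` steps on to the neighbour of the earlier one.
        arc : ∃[ e ] suc d + e ≡ m
        arc = m≤n⇒∃[o]m+o≡n (≤-trans (m≤n+m (suc d) j) (≤-trans j′≤k (k≤m 0<k)))
        e = proj₁ arc
        e-eq = proj₂ arc
        e<m : e < m
        e<m = ≤-trans (s≤s (m≤n+m e d)) (≤-reflexive e-eq)
        -- The path segment has `r` edges, with `r = suc d` in general but `r = d` for `j = 0`,
        -- where `pred` truncates. In both cases `d ≤ r`, enough to exceed `m` by one.
        segment : ∀ j → ∃[ r ] (pred j + r ≡ j + d × d ≤ r)
        segment zero    = d , refl , ≤-refl
        segment (suc a) = suc d , +-suc a d , n≤1+n d
        r = proj₁ (segment j)
        r-eq = proj₁ (proj₂ (segment j))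
        d≤r = proj₂ (proj₂ (segment j))
        inside : ∀ {u} → u ≤ r → pred j + u < k
        inside {u} u≤r = ≤-trans (s≤s (≤-trans (+-monoʳ-≤ (pred j) u≤r) (≤-reflexive r-eq)))
          (subst (_≤ k) (+-suc j d) j′≤k)
        wrap : c (j + suc d + p + e) ≡ c (j + p)
        wrap = trans (cong c (trans (shuffle j (suc d) p e) (cong (j + p +_) e-eq))) (C.periodic (j + p))
          where
          shuffle : ∀ j d p e → j + d + p + e ≡ j + p + (d + e)
          shuffle = solve-∀
        exit : c (j + suc d + p + e) ~ q (pred j + 0)
        exit = subst₂ _~_ (≡-sym wrap) (cong q (≡-sym (+-identityʳ (pred j)))) (~-sym (proj₂ (∈-hits⁻ {j} p∈)))
        entry : q (pred j + r) ~ c (j + suc d + p)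
        entry = subst (λ y → q y ~ c (j + suc d + p)) (trans (cong pred (+-suc j d)) (≡-sym r-eq))
          (proj₂ (∈-hits⁻ {j + suc d} p∈′))

      acc-unique : ∀ j → j ≤ k → Unique (acc j)
      acc-unique zero    _   = hits-unique 0
      acc-unique (suc j) j<k = ++⁺ (hits-unique (suc j)) (acc-unique j (<⇒≤ j<k)) disjoint
        where
        disjoint : ∀ {p} → ¬ (p ∈ hits (suc j) × p ∈ acc j)
        disjoint {p} (p∈ , p∈acc) with ∈-acc⁻ {j} p∈acc
        ... | i , i≤j , p∈i with m≤n⇒∃[o]m+o≡n i≤j
        ...   | d , refl = hits-disjoint (subst (_≤ k) (≡-sym (+-suc i d)) j<k) p∈i
          (subst (λ x → p ∈ hits x) (≡-sym (+-suc i d)) p∈)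

      -- The two lists of `q 0` contribute `1 + k` each, and the inner path vertices `q 1`, ...,
      -- `q j` contribute `k` each. The last path vertex is left out, since its bound is better by
      -- one.
      acc-bound : ∀ j → suc j < k → 2 * (1 + k) + j * k ≤ length (acc (suc j))
      acc-bound zero 1<k = subst (_≤ length (acc 1)) (≡-sym (+-identityʳ _)) (begin
        2 * (1 + k)                          ≡⟨ cong (1 + k +_) (+-identityʳ (1 + k)) ⟩
        (1 + k) + (1 + k)                    ≤⟨ +-mono-≤ (hits-first 1 refl (<⇒≤ 1<k)) (hits-first 0 refl (<⇒≤ 1<k)) ⟩
        length (hits 1) + length (hits 0)    ≡⟨ length-++ (hits 1) ⟨
        length (acc 1)                       ∎)
        where open ≤-Reasoning
      acc-bound (suc j) j<k = begin
        2 * (1 + k) + (k + j * k)                     ≡⟨ shuffle (2 * (1 + k)) k (j * k) ⟩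
        k + (2 * (1 + k) + j * k)                     ≤⟨ +-mono-≤ (hits-middle j (<⇒≤ j<k)) (acc-bound j (<⇒≤ j<k)) ⟩
        length (hits (2 + j)) + length (acc (suc j))  ≡⟨ length-++ (hits (2 + j)) ⟨
        length (acc (2 + j))                          ∎
        where
        open ≤-Reasoning
        shuffle : ∀ a b c → a + (b + c) ≡ b + (a + c)
        shuffle = solve-∀

      m-bound : 0 < k → k * k + k + 3 ≤ m
      m-bound 0<k = begin
        k * k + k + 3    ≤⟨ acc-total 0<k ⟩
        length (acc k)   ≤⟨ unique-⊆⇒length≤ (acc-unique k ≤-refl) (acc-⊆ {k}) ⟩
        length (upTo m)  ≡⟨ length-upTo m ⟩
        m                ∎
        where
        open ≤-Reasoning
        add-last : ∀ {j a b} → suc j ≡ k → a ≤ length (hits k) → b ≤ length (acc j) → a + b ≤ length (acc k)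
        add-last {j} refl a≤ b≤ = ≤-trans (+-mono-≤ a≤ b≤) (≤-reflexive (≡-sym (length-++ (hits k))))
        count₁ : ∀ k → 1 ≡ k → (2 + k) + (1 + k) ≡ k * k + k + 3
        count₁ _ refl = refl
        count : ∀ j k → 2 + j ≡ k → (1 + k) + (2 * (1 + k) + j * k) ≡ k * k + k + 3
        count j _ refl = identity j
          where
          identity : ∀ j → (1 + (2 + j)) + (2 * (1 + (2 + j)) + j * (2 + j)) ≡ (2 + j) * (2 + j) + (2 + j) + 3
          identity = solve-∀
        acc-total : 0 < k → k * k + k + 3 ≤ length (acc k)
        acc-total 0<k with m≤n⇒∃[o]m+o≡n 0<k
        -- For `k = 1` the first and the last path vertex coincide, and the two lists give 3 + 2 =
        -- 5.
        ... | zero  , 1≡k = subst (_≤ length (acc k)) (count₁ k 1≡k)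
          (add-last 1≡k (hits-only 1≡k) (hits-first 0 refl 0<k))
        ... | suc j , eq = subst (_≤ length (acc k)) (count j k eq)
          (add-last eq (hits-last j eq) (acc-bound j (≤-reflexive eq)))

theorem1p3 : (n k : ℕ) → 1 ≤ n → 1 ≤ k → k ≤ n → n < k * k + 2 * k + 3 →
    (G : Graph n) → ¬ InΓ n k G
theorem1p3 n k _ 1≤k@(s≤s {n = k-1} _) k≤n n<bound G ((longest-cycle , longest) , hamiltonian)
  -- Some cycle has length `n ∸ k`, so this number is at least 3 and can be written as `3 + o`.
  with m≤n⇒∃[o]m+o≡n (≤-trans (CycleOfLength.atLeast3 longest-cycle)
         (≤-reflexive (≡-sym (CycleOfLength.len≡ longest-cycle))))
... | o , m≡n∸k = <⇒≱ n<bound (begin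
  k * k + 2 * k + 3    ≡⟨ identity k ⟩
  k * k + k + 3 + k    ≤⟨ +-monoˡ-≤ k (m-bound G k o m+k≡n longest′ hamiltonian′ (proj₂ path) cycle 1≤k) ⟩
  3 + o + k            ≡⟨ m+k≡n ⟩
  n                    ∎)
  where
  open ≤-Reasoning
  identity : ∀ k → k * k + 2 * k + 3 ≡ k * k + k + 3 + k
  identity = solve-∀
  m+k≡n : 3 + o + k ≡ n
  m+k≡n = trans (cong (_+ k) m≡n∸k) (m∸n+n≡m k≤n)
  longest′ : ∀ {ℓ} → CycleOfLength G ℓ → ℓ ≤ 3 + o
  longest′ {ℓ} cyc = subst (ℓ ≤_) (≡-sym m≡n∸k) (longest ℓ cyc)
  hamiltonian′ : (f : Fin (3 + o) → Fin n) → Injective _≡_ _≡_ f → Hamiltonian (induced G f)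
  hamiltonian′ = subst (λ x → (f : Fin x → Fin n) → Injective _≡_ _≡_ f → Hamiltonian (induced G f))
    (≡-sym m≡n∸k) hamiltonian
  path : ∃[ q ] IsInducedPath G q k
  -- One vertex and `k-1` prolongations give `k` vertices.
  path = induced-path G k o m+k≡n longest′ hamiltonian′ k-1 (n≤1+n k-1)
  cycle : CycleAvoiding G (applyUpTo (proj₁ path) k) (3 + o)
  cycle = cycle-avoiding G k o m+k≡n longest′ hamiltonian′ (length-applyUpTo (proj₁ path) k)
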